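{- Let $X$ be a finite set. Every regular interval $[U,V]\subseteq\operatorname{Bip}(X)$ is isomorphic to a direct product of Boolean lattices and lattices of the form $\operatorname{Bip}(B)$, where each $B$ is a block both in the ordered bipartition representation of $U$ and in that of $V$, such that $B$ is nonunderlined in $U$ and underlined in $V$.
   Context: A relation $U\subseteq X\times X$ on a finite set $X$ is bipartitional if both $U$ and $(X\times X)\setminus U$ are transitive. $\operatorname{Bip}(X)$ is the set of bipartitional relations on $X$, partially ordered by inclusion. An ordered partition of $X$ is an ordered list $(B_1,\ldots,B_k)$ of pairwise disjoint nonempty subsets (blocks) with union $X$. Every bipartitional relation $U$ on $X$ is represented by a unique pair consisting of an ordered partition $(B_1,\ldots,B_k)$ of $X$ and a vector $(\varepsilon_1,\ldots,\varepsilon_k)\in\{0,1\}^k$ via: $(x,y)\in U$ if and only if either $x\in B_i$, $y\in B_j$ for some $i<j$, or $x,y\in B_i$ for some $i$ with $\varepsilon_i=1$. This pair is the ordered bipartition representation of $U$; the block $B_i$ is underlined if $\varepsilon_i=1$ and nonunderlined if $\varepsilon_i=0$. For a bipartitional relation $U$, write $x\sim_U y$ if either both or none of $(x,y)$ and $(y,x)$ belong to $U$; this is an equivalence relation whose classes are the blocks $B_i$ of $U$. An interval $[U,V]\subseteq\operatorname{Bip}(X)$ is called regular if every $x\in X$ satisfying $(x,x)\in V\setminus U$ also satisfies $\{y\in X: x\sim_U y\}=\{y\in X: x\sim_V y\}$. -}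

module Defs where

open import Data.Bool.Base using (Bool; true)
open import Data.Fin.Base using (Fin; _<_)
open import Data.Nat.Base using (ℕ)
open import Data.Product.Base using (_×_; _,_; ∃; ∃₂; proj₁)
open import Data.Refinement using (Refinement)
open import Data.Sum.Base using (_⊎_)
open import Level using (Level; _⊔_; 0ℓ) renaming (suc to lsuc)
open import Relation.Binary.Bundles using (Poset)
open import Relation.Binary.Core using (Rel; _⇒_; _⇔_)
open import Relation.Binary.Definitions using (Decidable; Transitive)
open import Relation.Binary.Indexed.Homogeneous.Bundles using (IndexedPoset)
open import Relation.Binary.Morphism.Structures using (IsOrderIsomorphism)
open import Relation.Binary.PropositionalEquality.Core using (_≡_; _≢_)
open import Relation.Nullary.Negation.Core using (¬_)
open import Relation.Unary using (Pred; _∈_; _≐_; _⊥_; Satisfiable)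
import Relation.Binary.Construct.On as On

private
  variable
    a ℓ₁ ℓ₂ b ℓ₃ ℓ₄ : Level
    X : Set

infix 4 _≅_

_≅_ : Poset a ℓ₁ ℓ₂ → Poset b ℓ₃ ℓ₄ → Set (a ⊔ ℓ₁ ⊔ ℓ₂ ⊔ b ⊔ ℓ₃ ⊔ ℓ₄)
P ≅ Q = ∃ λ f → IsOrderIsomorphism P._≈_ Q._≈_ P._≤_ Q._≤_ f
  where
  module P = Poset P
  module Q = Poset Q

Π-poset : {I : Set} → (I → Poset a ℓ₁ ℓ₂) → Poset a ℓ₁ ℓ₂
Π-poset {I = I} P = IndexedPoset.poset indexed
  where
  module P i = Poset (P i)

  indexed : IndexedPoset I _ _ _
  indexed = record
    { Carrierᵢ        = P.Carrier
    ; _≈ᵢ_            = λ {i} → P._≈_ i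
    ; _≤ᵢ_            = λ {i} → P._≤_ i
    ; isPartialOrderᵢ = record
      { isPreorderᵢ = record
        { isEquivalenceᵢ = record
          { reflᵢ  = λ {i} → P.Eq.refl i
          ; symᵢ   = λ {i} → P.Eq.sym i
          ; transᵢ = λ {i} → P.Eq.trans i
          }
        ; reflexiveᵢ = λ {i} → P.reflexive i
        ; transᵢ     = λ {i} → P.trans i
        }
      ; antisymᵢ = λ {i} → P.antisym i
      }
    }

interval : (P : Poset a ℓ₁ ℓ₂) → (u v : Poset.Carrier P) → Poset (a ⊔ ℓ₂) ℓ₁ ℓ₂
interval P u v = On.poset P (proj₁ {B = λ w → (u ≤ w) × (w ≤ v)})
  where open Poset P using (_≤_)

-- Relations on a finite set are subsets of a finite set, hence decidable.
-- Classically the field `dec` is no restriction.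
record Bipartitional (X : Set) : Set₁ where
  field
    rel          : Rel X 0ℓ
    dec          : Decidable rel
    transitive   : Transitive rel
    ctransitive  : Transitive (λ x y → ¬ rel x y)

open Bipartitional public using (rel)

Bip : Set → Poset (lsuc 0ℓ) 0ℓ 0ℓ
Bip X = record
  { Carrier        = Bipartitional X
  ; _≈_            = λ U V → rel U ⇔ rel V
  ; _≤_            = λ U V → rel U ⇒ rel V
  ; isPartialOrder = record
    { isPreorder = record
      { isEquivalence = record
        { refl  = (λ p → p) , (λ p → p)
        ; sym   = λ (f , g) → g , f
        ; trans = λ (f , g) (h , k) → (λ p → h (f p)) , (λ p → g (k p))
        }
      ; reflexive = λ (f , _) → f
      ; trans     = λ f g p → g (f p)
      }
    ; antisym = λ f g → f , g
    }
  }

-- A subset is turned into a type by proof-irrelevant comprehension, so that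
-- its elements are elements of X, however many proofs of membership there are.
BipOn : Pred X 0ℓ → Poset (lsuc 0ℓ) 0ℓ 0ℓ
BipOn {X} B = Bip (Refinement X B)

record OrderedPartition (X : Set) : Set₁ where
  field
    size     : ℕ
    block    : Fin size → Pred X 0ℓ
    nonempty : ∀ i → Satisfiable (block i)
    disjoint : ∀ {i j} → i ≢ j → block i ⊥ block j
    cover    : ∀ x → ∃ λ i → x ∈ block i

record OrderedBipartition (X : Set) : Set₁ where
  field
    partition : OrderedPartition X

  open OrderedPartition partition public

  field
    underlined : Fin size → Bool

  represented : Rel X 0ℓ
  represented x y =
      (∃₂ λ i j → x ∈ block i × y ∈ block j × i < j)
    ⊎ (∃ λ i → x ∈ block i × y ∈ block i × underlined i ≡ true)

-- B is a block in the ordered bipartition representation of U, underlined if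
-- ε is true and nonunderlined if ε is false.
IsBlock : Bipartitional X → Bool → Pred X 0ℓ → Set₁
IsBlock {X} U ε B = ∃ λ (ρ : OrderedBipartition X) →
  let open OrderedBipartition ρ in
  (rel U ⇔ represented) × (∃ λ i → B ≐ block i × underlined i ≡ ε)

_∼[_]_ : X → Bipartitional X → X → Set
x ∼[ U ] y = (rel U x y × rel U y x) ⊎ (¬ rel U x y × ¬ rel U y x)

Regular : Bipartitional X → Bipartitional X → Set
Regular U V = ∀ x → rel V x x × ¬ rel U x x → (x ∼[ U ]_) ≐ (x ∼[ V ]_)

{-# OPTIONS --safe #-}
module Submission where

-- A pair in V ∖ U never leaves a set of one of three kinds: the solid points
-- (x , x) ∈ U, the hollow points (x , x) ∉ V, and each class of free points
-- (x , x) ∈ V ∖ U, which by regularity is a block of both U and V.  Hence a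
-- member W of [U , V] is an arbitrary choice of a member on each of these sets.
-- On a free block U is empty and V is full, so W is arbitrary there.  On the
-- solid points W is a total preorder between U and V, so it is obtained from U
-- by merging consecutive classes and is determined by the set of classes that
-- are merged with their predecessor.  Complementation exchanges solid and
-- hollow points.

open import Defs
open import Data.Bool.Base using (true; false)
open import Data.Fin.Base using (Fin; zero; suc; _<_)
open import Data.Fin.Induction using (spo-wellFounded)
open import Data.Fin.Properties using (any?; all?; <-cmp) renaming (_≟_ to _≟ᶠ_)
open import Data.Fin.Subset using (Subset; ∁) renaming (_∈_ to _∈ₛ_; _⊆_ to _⊆ₛ_)
open import Data.Fin.Subset.Properties
  using (⊆-poset; ⊆-antisym; _∈?_; p⊆q⇒∁p⊇∁q; ∁p⊆∁q⇒p⊇q; x∈∁p⇒x∉p; x∉p⇒x∈∁p; x∈p⇒x∉∁p; x∉∁p⇒x∈p)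
open import Data.Irrelevant using ([_])
open import Data.List.Base using (List; []; _∷_; length; lookup)
open import Data.List.Membership.Propositional.Properties using (∈-lookup)
open import Data.List.Relation.Unary.All as All using (All; []; _∷_)
open import Data.List.Relation.Unary.AllPairs using (AllPairs; []; _∷_)
open import Data.List.Relation.Unary.Any as Any using (Any; here; there)
open import Data.List.Relation.Unary.Any.Properties using (lookup-index)
open import Data.Nat.Base using (ℕ; zero; suc; s≤s)
open import Data.Product.Base using (Σ-syntax; _×_; _,_; ∃; proj₁; proj₂)
open import Data.Product.Relation.Binary.Pointwise.NonDependent using (×-poset)
open import Data.Refinement using (Refinement; _,_; value)
open import Data.Sum.Base using (_⊎_; inj₁; inj₂)
open import Data.Sum.Properties renaming (≡-dec to ⊎-≡-dec)
open import Data.Vec.Base using (tabulate)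
open import Data.Vec.Properties using (lookup∘tabulate; []=⇒lookup; lookup⇒[]=)
open import Function.Base using (_∘_; flip)
open import Function.Bundles using (_↔_; module Inverse)
open import Induction.WellFounded using (WellFounded; Acc; acc; module Subrelation)
open import Level using (0ℓ)
open import Relation.Binary.Bundles using (Poset)
open import Relation.Binary.Core using (Rel)
open import Relation.Binary.Definitions using (DecidableEquality; Irreflexive; Transitive; tri<; tri≈; tri>)
open import Relation.Binary.PropositionalEquality using (_≡_; _≢_; refl; sym; trans; cong; subst; subst₂; resp₂; isEquivalence)
import Relation.Binary.Construct.On as On
open import Relation.Nullary.Decidable using (Dec; yes; no; does; map′; ¬?; _×-dec_; _⊎-dec_; _→-dec_; decidable-stable; dec-true; dec-false; recompute)
open import Relation.Nullary.Negation.Core using (¬_; contradiction)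
open import Relation.Unary using (Pred; _≐_) renaming (Decidable to Decidable₁)

private
  variable
    X : Set
    n : ℕ

-- Order isomorphisms, finite subsets and finite carriers.

mk≅ : ∀ {a ℓ₁ ℓ₂ b ℓ₃ ℓ₄} (P : Poset a ℓ₁ ℓ₂) (Q : Poset b ℓ₃ ℓ₄) →
  let module P = Poset P ; module Q = Poset Q in
  (f : P.Carrier → Q.Carrier) →
  (∀ {x y} → x P.≤ y → f x Q.≤ f y) →
  (∀ {x y} → f x Q.≤ f y → x P.≤ y) →
  (∀ q → ∃ λ p → f p Q.≈ q) →
  P ≅ Q
mk≅ P Q f mono cancel onto = f , record
  { isOrderMonomorphism = record
    { isOrderHomomorphism = record { cong = f-cong ; mono = mono }
    ; injective = λ e → P.antisym (cancel (Q.reflexive e)) (cancel (Q.reflexive (Q.Eq.sym e)))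
    ; cancel = cancel
    }
  ; surjective = λ q → let p , e = onto q in p , λ z≈p → Q.Eq.trans (f-cong z≈p) e
  }
  where
  module P = Poset P
  module Q = Poset Q

  f-cong : ∀ {x y} → x P.≈ y → f x Q.≈ f y
  f-cong e = Q.antisym (mono (P.reflexive e)) (mono (P.reflexive (P.Eq.sym e)))

module _ {P : Pred (Fin n) 0ℓ} (P? : Decidable₁ P) where

  subset : Subset n
  subset = tabulate (λ i → does (P? i))

  ∈-subset⁺ : ∀ {i} → P i → i ∈ₛ subset
  ∈-subset⁺ {i} p = lookup⇒[]= i subset (trans (lookup∘tabulate _ i) (dec-true (P? i) p))

  ∈-subset⁻ : ∀ {i} → i ∈ₛ subset → P i
  ∈-subset⁻ {i} i∈ with P? i | trans (sym (lookup∘tabulate _ i)) ([]=⇒lookup i∈)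
  ... | yes p | _  = p
  ... | no _  | ()

AllPairs-lookup : {A : Set} {R : Rel A 0ℓ} {xs : List A} → AllPairs R xs →
  ∀ {i j} → i < j → R (lookup xs i) (lookup xs j)
AllPairs-lookup (px ∷ _)  {zero}  {suc j} _         = All.lookup px (∈-lookup j)
AllPairs-lookup (_  ∷ ps) {suc i} {suc j} (s≤s i<j) = AllPairs-lookup ps i<j

module Finite (fin : X ↔ Fin n) where
  open Inverse fin

  from∘to : ∀ x → from (to x) ≡ x
  from∘to x = inverseʳ refl

  satisfiable? : {P : Pred X 0ℓ} → Decidable₁ P → Dec (∃ P)
  satisfiable? {P} P? = map′ (λ (i , p) → from i , p)
    (λ (x , p) → to x , subst P (sym (from∘to x)) p) (any? (P? ∘ from))

  wellFounded : {_⊏_ : Rel X 0ℓ} → Irreflexive _≡_ _⊏_ → Transitive _⊏_ → WellFounded _⊏_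
  wellFounded {_⊏_} irrefl ⊏-trans =
    Subrelation.wellFounded (subst₂ _⊏_ (sym (from∘to _)) (sym (from∘to _)))
      (On.wellFounded to (spo-wellFounded {_⊏_ = λ i j → from i ⊏ from j} record
        { isEquivalence = isEquivalence
        ; irrefl        = irrefl ∘ cong from
        ; trans         = ⊏-trans
        ; <-resp-≈      = resp₂ _
        }))

-- The equivalence and the strict order of blocks.

module BlockOrder (U : Bipartitional X) where
  open Bipartitional U hiding (rel)

  infix 4 _∼_ _≺_

  _∼_ : Rel X 0ℓ
  x ∼ y = x ∼[ U ] y

  _≺_ : Rel X 0ℓ
  x ≺ y = rel U x y × ¬ rel U y x

  ∼-intro : ∀ {x y} → (rel U x y → rel U y x) → (rel U y x → rel U x y) → x ∼ y
  ∼-intro {x} {y} f g with dec x y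
  ... | yes u = inj₁ (u , f u)
  ... | no ¬u = inj₂ (¬u , ¬u ∘ g)

  ∼-refl : ∀ {x} → x ∼ x
  ∼-refl = ∼-intro (λ u → u) (λ u → u)

  ∼-sym : ∀ {x y} → x ∼ y → y ∼ x
  ∼-sym (inj₁ (u , v)) = inj₁ (v , u)
  ∼-sym (inj₂ (u , v)) = inj₂ (v , u)

  ∼-flip : ∀ {x y} → x ∼ y → rel U x y → rel U y x
  ∼-flip (inj₁ (_ , v))  _ = v
  ∼-flip (inj₂ (¬u , _)) u = contradiction u ¬u

  -- When `x` and `y` are unrelated both ways, transitivity of the complement takes over: absence of
  -- `(x , y)` and `(y , z)` would exclude `(x , z)`.
  rel-respˡ : ∀ {x y z} → x ∼ y → rel U x z → rel U y z
  rel-respˡ (inj₁ (_ , yx)) xz = transitive yx xz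
  rel-respˡ (inj₂ (¬xy , _)) xz = decidable-stable (dec _ _) λ ¬yz → ctransitive ¬xy ¬yz xz

  rel-respʳ : ∀ {x y z} → x ∼ y → rel U z x → rel U z y
  rel-respʳ (inj₁ (xy , _)) zx = transitive zx xy
  rel-respʳ (inj₂ (_ , ¬yx)) zx = decidable-stable (dec _ _) λ ¬zy → ctransitive ¬zy ¬yx zx

  rel-diagonal : ∀ {x y} → x ∼ y → rel U x x → rel U y y
  rel-diagonal x∼y = rel-respˡ x∼y ∘ rel-respʳ x∼y

  -- Were both pairs absent, transitivity of the complement would exclude `(x , x)`. Hence `U` is a
  -- total preorder on its solid points.
  rel-total : ∀ {x y} → rel U x x → ¬ rel U x y → rel U y x
  rel-total xx ¬xy = decidable-stable (dec _ _) λ ¬yx → ctransitive ¬xy ¬yx xx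

  ∼-trans : ∀ {x y z} → x ∼ y → y ∼ z → x ∼ z
  ∼-trans p q = ∼-intro
    (rel-respʳ (∼-sym p) ∘ ∼-flip q ∘ rel-respˡ p)
    (rel-respˡ (∼-sym p) ∘ ∼-flip (∼-sym q) ∘ rel-respʳ p)

  _∼?_ : ∀ x y → Dec (x ∼ y)
  x ∼? y = (dec x y ×-dec dec y x) ⊎-dec (¬? (dec x y) ×-dec ¬? (dec y x))

  ≺-cmp : ∀ x y → x ≺ y ⊎ x ∼ y ⊎ y ≺ x
  ≺-cmp x y with dec x y | dec y x
  ... | yes u | no ¬v = inj₁ (u , ¬v)
  ... | yes u | yes v = inj₂ (inj₁ (inj₁ (u , v)))
  ... | no ¬u | no ¬v = inj₂ (inj₁ (inj₂ (¬u , ¬v)))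
  ... | no ¬u | yes v = inj₂ (inj₂ (v , ¬u))

  ≺-irrefl : Irreflexive _≡_ _≺_
  ≺-irrefl refl (u , ¬u) = ¬u u

  ≺-trans : Transitive _≺_
  ≺-trans (xy , ¬yx) (yz , ¬zy) = transitive xy yz , ctransitive ¬zy ¬yx

  ≺⇒≁ : ∀ {x y} → x ≺ y → ¬ x ∼ y
  ≺⇒≁ (u , ¬v) x∼y = ¬v (∼-flip x∼y u)

-- Increasing representatives of the classes meeting a set.

record Transversal (U : Bipartitional X) (P : Pred X 0ℓ) : Set where
  open BlockOrder U
  field
    size   : ℕ
    rep    : Fin size → X
    holds  : ∀ i → P (rep i)
    mono   : ∀ {i j} → i < j → rep i ≺ rep j
    covers : ∀ {x} → P x → ∃ λ i → rep i ∼ x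

  injective : ∀ {i j} → rep i ∼ rep j → i ≡ j
  injective {i} {j} e with <-cmp i j
  ... | tri< i<j _ _ = contradiction e (≺⇒≁ (mono i<j))
  ... | tri≈ _ i≡j _ = i≡j
  ... | tri> _ _ j<i = contradiction (∼-sym e) (≺⇒≁ (mono j<i))

module Sorting (U : Bipartitional X) where
  open BlockOrder U

  insert : X → List X → List X
  insert x [] = x ∷ []
  insert x (y ∷ ys) with ≺-cmp x y
  ... | inj₁ _        = x ∷ y ∷ ys
  ... | inj₂ (inj₁ _) = y ∷ ys
  ... | inj₂ (inj₂ _) = y ∷ insert x ys

  insert-All : ∀ {P : Pred X 0ℓ} {x ys} → P x → All P ys → All P (insert x ys)
  insert-All px [] = px ∷ []
  insert-All {x = x} {y ∷ _} px (py ∷ pys) with ≺-cmp x y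
  ... | inj₁ _        = px ∷ py ∷ pys
  ... | inj₂ (inj₁ _) = py ∷ pys
  ... | inj₂ (inj₂ _) = py ∷ insert-All px pys

  insert-sorted : ∀ {x ys} → AllPairs _≺_ ys → AllPairs _≺_ (insert x ys)
  insert-sorted [] = [] ∷ []
  insert-sorted {x} {y ∷ _} (y≺ys ∷ s) with ≺-cmp x y
  ... | inj₁ x≺y        = (x≺y ∷ All.map (≺-trans x≺y) y≺ys) ∷ y≺ys ∷ s
  ... | inj₂ (inj₁ _)   = y≺ys ∷ s
  ... | inj₂ (inj₂ y≺x) = insert-All y≺x y≺ys ∷ insert-sorted s

  insert-new : ∀ x ys → Any (_∼ x) (insert x ys)
  insert-new x [] = here ∼-refl
  insert-new x (y ∷ ys) with ≺-cmp x y
  ... | inj₁ _          = here ∼-refl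
  ... | inj₂ (inj₁ x∼y) = here (∼-sym x∼y)
  ... | inj₂ (inj₂ _)   = there (insert-new x ys)

  insert-old : ∀ {P : Pred X 0ℓ} x {ys} → Any P ys → Any P (insert x ys)
  insert-old x {y ∷ _} p with ≺-cmp x y | p
  ... | inj₁ _        | p       = there p
  ... | inj₂ (inj₁ _) | p       = p
  ... | inj₂ (inj₂ _) | here p  = here p
  ... | inj₂ (inj₂ _) | there p = there (insert-old x p)

  module _ {P : Pred X 0ℓ} (P? : Decidable₁ P) where

    sort : ∀ {m} (f : Fin m → X) → ∃ λ ys →
      AllPairs _≺_ ys × All P ys × (∀ i → P (f i) → Any (_∼ f i) ys)
    sort {zero} f = [] , [] , [] , λ ()
    sort {suc m} f with sort (f ∘ suc) | P? (f zero)
    ... | ys , s , a , c | yes p = insert (f zero) ys , insert-sorted s , insert-All p a ,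
      λ { zero _ → insert-new (f zero) ys ; (suc i) q → insert-old (f zero) (c i q) }
    ... | ys , s , a , c | no ¬p = ys , s , a ,
      λ { zero p → contradiction p ¬p ; (suc i) q → c i q }

    transversal : X ↔ Fin n → Transversal U P
    transversal fin with sort (Inverse.from fin)
    ... | ys , s , a , c = record
      { size   = length ys
      ; rep    = lookup ys
      ; holds  = λ i → All.lookup a (∈-lookup i)
      ; mono   = AllPairs-lookup s
      ; covers = λ {x} p →
          let x∈ = subst (λ y → P y → Any (_∼ y) ys) (Finite.from∘to fin x) (c (Inverse.to fin x)) p
          in Any.index x∈ , lookup-index x∈
      }

-- The ordered bipartition representation.

module Representation (fin : X ↔ Fin n) (U : Bipartitional X) where
  open BlockOrder U
  open Bipartitional U hiding (rel)
  -- The predicate `λ _ → X` holds everywhere, each point being its own witness, so every class gets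
  -- a representative.
  open Transversal (Sorting.transversal U {P = λ _ → X} (λ x → yes x) fin) renaming (mono to rep-mono)

  representation : OrderedBipartition X
  representation = record
    { partition = record
      { size     = size
      ; block    = λ i x → rep i ∼ x
      ; nonempty = λ i → rep i , ∼-refl
      ; disjoint = λ i≢j (p , q) → i≢j (injective (∼-trans p (∼-sym q)))
      ; cover    = λ x → covers x
      }
    ; underlined = λ i → does (dec (rep i) (rep i))
    }

  open OrderedBipartition representation using (represented)

  underlined⁻ : ∀ {x} → does (dec x x) ≡ true → rel U x x
  underlined⁻ {x} e with dec x x
  ... | yes u = u

  rel⇒represented : ∀ {x y} → rel U x y → represented x y
  rel⇒represented {x} {y} u with covers x | covers y
  ... | i , p | j , q with <-cmp i j
  ...   | tri< i<j _ _ = inj₁ (i , j , p , q , i<j)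
  ...   | tri≈ _ refl _ = inj₂ (i , p , q ,
    dec-true (dec _ _) (rel-respʳ (∼-sym q) (rel-respˡ (∼-sym p) u)))
  ...   | tri> _ _ j<i = contradiction (rel-respʳ (∼-sym q) (rel-respˡ (∼-sym p) u)) (proj₂ (rep-mono j<i))

  represented⇒rel : ∀ {x y} → represented x y → rel U x y
  represented⇒rel (inj₁ (i , j , p , q , i<j)) = rel-respʳ q (rel-respˡ p (proj₁ (rep-mono i<j)))
  represented⇒rel (inj₂ (i , p , q , e))       = rel-respʳ q (rel-respˡ p (underlined⁻ e))

  isBlock : ∀ x {ε} → does (dec x x) ≡ ε → {B : Pred X 0ℓ} → B ≐ (x ∼_) → IsBlock U ε B
  isBlock x refl (B⊆ , ⊆B) with covers x
  ... | i , i∼x = representation , (rel⇒represented , represented⇒rel) , i ,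
    ((λ b → ∼-trans i∼x (B⊆ b)) , (λ p → ⊆B (∼-trans (∼-sym i∼x) p))) ,
    does-⇔ (dec _ _) (dec _ _) (rel-diagonal i∼x) (rel-diagonal (∼-sym i∼x))
    where
    does-⇔ : ∀ {A B : Set} (a? : Dec A) (b? : Dec B) → (A → B) → (B → A) → does a? ≡ does b?
    does-⇔ (yes a) b? f g = sym (dec-true b? (f a))
    does-⇔ (no ¬a) b? f g = sym (dec-false b? (¬a ∘ g))

-- Complementation and local members of an interval.

infix 4 _≤ᵇ_
infix 8 ∁ᵇ_

∁ᵇ_ : Bipartitional X → Bipartitional X
∁ᵇ U = record
  { rel         = λ x y → ¬ rel U x y
  ; dec         = λ x y → ¬? (dec x y)
  ; transitive  = ctransitive
  ; ctransitive = λ ¬¬xy ¬¬yz ¬xz →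
      ¬xz (transitive (decidable-stable (dec _ _) ¬¬xy) (decidable-stable (dec _ _) ¬¬yz))
  }
  where open Bipartitional U hiding (rel)

_≤ᵇ_ : Rel (Bipartitional X) 0ℓ
U ≤ᵇ V = ∀ {x y} → rel U x y → rel V x y

∁ᵇ-antitone : {U V : Bipartitional X} → U ≤ᵇ V → ∁ᵇ V ≤ᵇ ∁ᵇ U
∁ᵇ-antitone U≤V ¬v = ¬v ∘ U≤V

-- The trace on `P` of a member of the interval. `L` is unconstrained off `P`, since relations such
-- as `Join` are controlled only on their own piece.
record MemberOn (U V : Bipartitional X) (P : Pred X 0ℓ) (L : Rel X 0ℓ) : Set where
  field
    dec-on         : ∀ {x y} → P x → P y → Dec (L x y)
    lower          : ∀ {x y} → P x → P y → rel U x y → L x y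
    upper          : ∀ {x y} → P x → P y → L x y → rel V x y
    transitive-on  : ∀ {x y z} → P x → P y → P z → L x y → L y z → L x z
    ctransitive-on : ∀ {x y z} → P x → P y → P z → ¬ L x y → ¬ L y z → ¬ L x z

∁-MemberOn : {U V : Bipartitional X} {P : Pred X 0ℓ} {L : Rel X 0ℓ} →
  MemberOn (∁ᵇ V) (∁ᵇ U) P L → MemberOn U V P (λ x y → ¬ L x y)
∁-MemberOn {V = V} M = record
  { dec-on         = λ px py → ¬? (dec-on px py)
  ; lower          = λ px py u l → upper px py l u
  ; upper          = λ px py ¬l → decidable-stable (Bipartitional.dec V _ _) (¬l ∘ lower px py)
  ; transitive-on  = ctransitive-on
  ; ctransitive-on = λ px py pz ¬¬xy ¬¬yz ¬xz → ¬xz (transitive-on px py pz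
      (decidable-stable (dec-on px py) ¬¬xy) (decidable-stable (dec-on py pz) ¬¬yz))
  }
  where open MemberOn M

-- Gluing local members along a partition into kinds.

module Glue
  {I : Set} (_≟_ : DecidableEquality I)
  (U V : Bipartitional X) (U≤V : U ≤ᵇ V)
  (K : I → Pred X 0ℓ)
  (kind : ∀ x → ∃ λ i → K i x)
  (kind-unique : ∀ {i j x} → K i x → K j x → i ≡ j)
  (kind-closed : ∀ i {x y} → K i x → rel V x y → ¬ rel U x y → K i y)
  (L : I → Rel X 0ℓ) (member : ∀ i → MemberOn U V (K i) (L i))
  where

  private
    module U = Bipartitional U
    module V = Bipartitional V
    module M i = MemberOn (member i)

  Glued : Rel X 0ℓ
  Glued x y = rel U x y ⊎ ∃ λ i → K i x × K i y × L i x y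

  glued⁺ : ∀ i {x y} → K i x → K i y → L i x y → Glued x y
  glued⁺ i kx ky l = inj₂ (i , kx , ky , l)

  glued⁻ : ∀ i {x y} → K i x → K i y → Glued x y → L i x y
  glued⁻ i kx ky (inj₁ u) = M.lower i kx ky u
  glued⁻ i kx ky (inj₂ (j , kx′ , _ , l)) with refl ← kind-unique kx kx′ = l

  glued⇒V : ∀ {x y} → Glued x y → rel V x y
  glued⇒V (inj₁ u)                  = U≤V u
  glued⇒V (inj₂ (i , kx , ky , l)) = M.upper i kx ky l

  -- Contrapositive of `kind-closed`: a pair in `V` but not in `U` would keep its second point in
  -- the kind of the first.
  V⇒U : ∀ {i j x y} → K i x → K j y → i ≢ j → rel V x y → rel U x y
  V⇒U kx ky i≢j v = decidable-stable (U.dec _ _) λ ¬u → i≢j (kind-unique (kind-closed _ kx v ¬u) ky)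

  glued? : ∀ x y → Dec (Glued x y)
  glued? x y with kind x | kind y
  ... | i , kx | j , ky with i ≟ j
  ...   | yes refl = map′ (glued⁺ i kx ky) (glued⁻ i kx ky) (M.dec-on i kx ky)
  ...   | no i≢j   = map′ inj₁ (V⇒U kx ky i≢j ∘ glued⇒V) (U.dec x y)

  -- If the ends differ in kind, `U` and `V` agree on them and transitivity of `V` suffices. If only
  -- the middle differs, both steps lie in `U`. Otherwise everything happens inside one kind.
  glued-transitive : Transitive Glued
  glued-transitive {x} {y} {z} xy yz with kind x | kind y | kind z
  ... | i , kx | j , ky | k , kz with i ≟ k
  ...   | no i≢k = inj₁ (V⇒U kx kz i≢k (V.transitive (glued⇒V xy) (glued⇒V yz)))
  ...   | yes refl with i ≟ j
  ...     | yes refl = glued⁺ i kx kz (M.transitive-on i kx ky kz (glued⁻ i kx ky xy) (glued⁻ i ky kz yz))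
  ...     | no i≢j = inj₁ (U.transitive (V⇒U kx ky i≢j (glued⇒V xy)) (V⇒U ky kz (i≢j ∘ sym) (glued⇒V yz)))

  -- The dual case split: ends of different kinds are handled by the complement of `U`, a middle of
  -- another kind by the complement of `V`.
  glued-ctransitive : Transitive (λ x y → ¬ Glued x y)
  glued-ctransitive {x} {y} {z} ¬xy ¬yz xz with kind x | kind y | kind z
  ... | i , kx | j , ky | k , kz with i ≟ k
  ...   | no i≢k = U.ctransitive (¬xy ∘ inj₁) (¬yz ∘ inj₁) (V⇒U kx kz i≢k (glued⇒V xz))
  ...   | yes refl with i ≟ j
  ...     | yes refl = M.ctransitive-on i kx ky kz (¬xy ∘ glued⁺ i kx ky) (¬yz ∘ glued⁺ i ky kz) (glued⁻ i kx kz xz)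
  ...     | no i≢j = V.ctransitive (¬xy ∘ inj₁ ∘ V⇒U kx ky i≢j) (¬yz ∘ inj₁ ∘ V⇒U ky kz (i≢j ∘ sym)) (glued⇒V xz)

  glue : Bipartitional X
  glue = record
    { rel         = Glued
    ; dec         = glued?
    ; transitive  = glued-transitive
    ; ctransitive = glued-ctransitive
    }

-- Merging consecutive classes on the solid points.

module Merging (fin : X ↔ Fin n) (U V : Bipartitional X) (U≤V : U ≤ᵇ V)
  (closed : ∀ {x y} → rel U x x → rel V x y → ¬ rel U x y → rel U y y)
  where

  open BlockOrder U
  open Finite fin
  private
    module U = Bipartitional U
    module V = Bipartitional V

  -- By `rel-total` such a `y` strictly precedes `x` in `U`, while `V` puts both in one class. So
  -- these are the solid classes of `U` that are not first within their class of `V`.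
  Mergeable : Pred X 0ℓ
  Mergeable x = rel U x x × ∃ λ y → rel V x y × ¬ rel U x y

  mergeable? : Decidable₁ Mergeable
  mergeable? x = U.dec x x ×-dec satisfiable? (λ y → V.dec x y ×-dec ¬? (U.dec x y))

  open Transversal (Sorting.transversal U mergeable? fin) public using (size; rep; holds; covers; injective)

  -- For `W` between `U` and `V`, a merge with any earlier class absorbs all classes in between, so
  -- it includes the predecessor. Asking for some `y` avoids naming that predecessor.
  Merged : Bipartitional X → Pred (Fin size) 0ℓ
  Merged W i = ∃ λ y → rel W (rep i) y × ¬ rel U (rep i) y

  merged? : ∀ W → Decidable₁ (Merged W)
  merged? W i = satisfiable? λ y → Bipartitional.dec W (rep i) y ×-dec ¬? (U.dec (rep i) y)

  merged : Bipartitional X → Subset size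
  merged W = subset (merged? W)

  merged-mono : ∀ W W′ → W ≤ᵇ W′ → merged W ⊆ₛ merged W′
  merged-mono W W′ W≤W′ i∈ with y , w , ¬u ← ∈-subset⁻ (merged? W) i∈ =
    ∈-subset⁺ (merged? W′) (y , W≤W′ w , ¬u)

  -- Well-founded induction on `x`. A pair `(x , y)` in `W` outside `U` makes the class of `x`
  -- merged in `W`, hence in `W′`, which yields `z ≺ x` with `(x , z)` in `W′`. Either `U` leads
  -- from `z` to `y`, or `(z , y)` is again in `W` and the induction applies.
  merged-cancel : ∀ W W′ → U ≤ᵇ W → W ≤ᵇ V → U ≤ᵇ W′ → W′ ≤ᵇ V →
    merged W ⊆ₛ merged W′ → ∀ {x y} → rel U x x → rel W x y → rel W′ x y
  merged-cancel W W′ U≤W W≤V U≤W′ W′≤V m⊆m′ {y = y} = go (wellFounded ≺-irrefl ≺-trans _)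
    where
    module W = Bipartitional W
    module W′ = Bipartitional W′

    go : ∀ {x} → Acc _≺_ x → rel U x x → rel W x y → rel W′ x y
    go {x} (acc rs) xx xy with U.dec x y
    ... | yes u = U≤W′ u
    ... | no ¬u with covers (xx , y , W≤V xy , ¬u)
    ...   | i , i∼x with ∈-subset⁻ (merged? W′) (m⊆m′ (∈-subset⁺ (merged? W)
                           (y , W.transitive (U≤W (rel-respˡ (∼-sym i∼x) xx)) xy , ¬u ∘ rel-respˡ i∼x)))
    ...     | z , iz , ¬Uiz = step (U.dec z y)
      where
      xz : rel W′ x z
      xz = W′.transitive (U≤W′ (rel-respʳ (∼-sym i∼x) xx)) iz

      ¬Uxz : ¬ rel U x z
      ¬Uxz = ¬Uiz ∘ rel-respˡ (∼-sym i∼x)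

      zx : rel U z x
      zx = rel-total xx ¬Uxz

      step : Dec (rel U z y) → rel W′ x y
      step (yes zy) = W′.transitive xz (U≤W′ zy)
      step (no _)   = W′.transitive xz
        (go (rs (zx , ¬Uxz)) (closed xx (W′≤V xz) ¬Uxz) (W.transitive (U≤W zx) xy))

  -- The index `i` ranges over the mergeable classes strictly after `y` and up to that of `x`, that
  -- is, those whose merges are needed to go back from `x` to `y`.
  Join : Subset size → Rel X 0ℓ
  Join S x y = rel V x y × (∀ i → rel U (rep i) x → ¬ rel U (rep i) y → i ∈ₛ S)

  U⇒join : ∀ S {x y} → rel U x y → Join S x y
  U⇒join S u = U≤V u , λ i ix ¬iy → contradiction (U.transitive ix u) ¬iy

  join-transitive : ∀ S → Transitive (Join S)
  join-transitive S {_} {y} (xy , f) (yz , g) = V.transitive xy yz , h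
    where
    h : ∀ i → _ → _ → i ∈ₛ S
    h i ix ¬iz with U.dec (rep i) y
    ... | yes iy = g i iy ¬iz
    ... | no ¬iy = f i ix ¬iy

  join-MemberOn : ∀ S → MemberOn U V (λ x → rel U x x) (Join S)
  join-MemberOn S = record
    { dec-on         = λ {x} {y} _ _ → V.dec x y ×-dec
        all? (λ i → U.dec (rep i) x →-dec (¬? (U.dec (rep i) y) →-dec (i ∈? S)))
    ; lower          = λ _ _ → U⇒join S
    ; upper          = λ _ _ → proj₁
    ; transitive-on  = λ _ _ _ → join-transitive S
    -- On solid points a missing `(x , y)` forces `(y , x)` into `U`, so transitivity of the
    -- complement reduces to that of `Join`.
    ; ctransitive-on = λ xx _ _ ¬xy ¬yz xz →
        ¬yz (join-transitive S (U⇒join S (rel-total xx (¬xy ∘ U⇒join S))) xz)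
    }

  -- The successive candidates climb to the predecessor of the class of rep i.
  join-merges : ∀ S {i} → i ∈ₛ S → ∃ λ y → Join S (rep i) y × ¬ rel U (rep i) y
  join-merges S {i} i∈S = let ii , y , iy , ¬iy = holds i in
    go (wellFounded (λ e → ≺-irrefl (sym e)) (flip ≺-trans) y) ii iy ¬iy
    where
    go : ∀ {y} → Acc (flip _≺_) y → rel U (rep i) (rep i) → rel V (rep i) y → ¬ rel U (rep i) y →
      ∃ λ y → Join S (rep i) y × ¬ rel U (rep i) y
    go {y} (acc rs) ii iy ¬iy
      with any? (λ j → U.dec (rep j) (rep i) ×-dec (¬? (U.dec (rep j) y) ×-dec ¬? (j ∈? S)))
    ... | no ∄j = y , (iy , λ j ji ¬jy → decidable-stable (j ∈? S) λ j∉S → ∄j (j , ji , ¬jy , j∉S)) , ¬iy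
    ... | yes (j , ji , ¬jy , j∉S) =
      go (rs (yj , ¬jy)) ii (V.transitive iy (U≤V yj))
        -- `rep j` still lies strictly before `rep i`: otherwise the two representatives would
        -- coincide, against `j ∉ S` and `i ∈ S`.
        λ ij → j∉S (subst (_∈ₛ S) (injective (inj₁ (ij , ji))) i∈S)
      where
      yj : rel U y (rep j)
      yj = rel-total (proj₁ (holds j)) ¬jy

  -- Agreement with `Join S` is asked only on solid points, where a glued relation is known;
  -- `closed` keeps the witnesses solid. The class of `rep i` is itself among those passed on the
  -- way to `y`, which puts `i` in `S`.
  merged-join : ∀ W S → W ≤ᵇ V →
    (∀ {x y} → rel U x x → rel U y y → rel W x y → Join S x y) →
    (∀ {x y} → rel U x x → rel U y y → Join S x y → rel W x y) →
    merged W ≡ S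
  merged-join W S W≤V W⇒J J⇒W = ⊆-antisym
    (λ {i} i∈ → let ii = proj₁ (holds i) ; y , iy , ¬iy = ∈-subset⁻ (merged? W) i∈ in
      proj₂ (W⇒J ii (closed ii (W≤V iy) ¬iy) iy) i ii ¬iy)
    (λ {i} i∈S → let ii = proj₁ (holds i) ; y , iy , ¬iy = join-merges S i∈S in
      ∈-subset⁺ (merged? W) (y , J⇒W ii (closed ii (proj₁ iy) ¬iy) iy , ¬iy))

-- Restriction to a block and consequences of regularity.

restrict : Bipartitional X → (B : Pred X 0ℓ) → Bipartitional (Refinement X B)
restrict W B = record
  { rel         = λ a b → rel W (value a) (value b)
  ; dec         = λ a b → dec (value a) (value b)
  ; transitive  = transitive
  ; ctransitive = ctransitive
  }
  where open Bipartitional W hiding (rel)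

-- Otherwise `y` is free: `(y , x)` lies in `U`, so `V` contains both pairs and `(y , y)`.
-- Regularity turns the equivalence of `x` and `y` in `V` into one in `U`, forcing `(x , y)` into
-- `U`.
solid-closed : {U V : Bipartitional X} → U ≤ᵇ V → Regular U V →
  ∀ {x y} → rel U x x → rel V x y → ¬ rel U x y → rel U y y
solid-closed {U = U} {V} U≤V regular {x} {y} xx xy ¬xy = decidable-stable (U.dec y y) λ ¬yy →
  let yx = BlockOrder.rel-total U xx ¬xy
      y∼x = proj₂ (regular y (V.transitive (U≤V yx) xy , ¬yy)) (inj₁ (U≤V yx , xy))
  in ¬xy (BlockOrder.∼-flip U y∼x yx)
  where
  module U = Bipartitional U
  module V = Bipartitional V

-- Complementing and exchanging the ends preserves their difference, and under complementation the
-- equivalence only swaps its two alternatives.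
∁-regular : {U V : Bipartitional X} → Regular U V → Regular (∁ᵇ V) (∁ᵇ U)
∁-regular {X = X} {U} {V} regular x (¬u , ¬¬v) =
  let f , g = regular x (decidable-stable (Bipartitional.dec V x x) ¬¬v , ¬u) in
  (λ p → ∼-∁⁺ U (g (∼-∁⁻ V p))) , (λ p → ∼-∁⁺ V (f (∼-∁⁻ U p)))
  where
  ∼-∁⁺ : ∀ (W : Bipartitional X) {x y} → x ∼[ W ] y → x ∼[ ∁ᵇ W ] y
  ∼-∁⁺ W (inj₁ (u , v)) = inj₂ ((λ ¬u → ¬u u) , (λ ¬v → ¬v v))
  ∼-∁⁺ W (inj₂ p)       = inj₁ p

  ∼-∁⁻ : ∀ (W : Bipartitional X) {x y} → x ∼[ ∁ᵇ W ] y → x ∼[ W ] y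
  ∼-∁⁻ W (inj₁ p)       = inj₂ p
  ∼-∁⁻ W (inj₂ (u , v)) = inj₁ (stable u , stable v)
    where
    stable : ∀ {x y} → ¬ ¬ rel W x y → rel W x y
    stable = decidable-stable (Bipartitional.dec W _ _)

-- The factors of a regular interval.

module RegularInterval (fin : X ↔ Fin n) (U V : Bipartitional X) (U≤V : U ≤ᵇ V) (regular : Regular U V) where

  private
    module U = Bipartitional U
    module V = Bipartitional V
    module U∼ = BlockOrder U
    module V∼ = BlockOrder V

  module Solid = Merging fin U V U≤V (solid-closed {U = U} {V} U≤V regular)
  module Hollow = Merging fin (∁ᵇ V) (∁ᵇ U) (∁ᵇ-antitone {U = U} {V} U≤V)
    (solid-closed {U = ∁ᵇ V} {∁ᵇ U} (∁ᵇ-antitone {U = U} {V} U≤V) (∁-regular {U = U} {V} regular))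

  Free : Pred X 0ℓ
  Free x = rel V x x × ¬ rel U x x

  free? : Decidable₁ Free
  free? x = V.dec x x ×-dec ¬? (U.dec x x)

  open Transversal (Sorting.transversal U free? fin)
    renaming (size to r; rep to free; holds to free-holds; covers to free-covers; injective to free-injective)

  B : Fin r → Pred X 0ℓ
  B j x = free j U∼.∼ x

  B-injective : ∀ {i j} → B i ≐ B j → i ≡ j
  B-injective (B⊆ , _) = sym (free-injective (B⊆ U∼.∼-refl))

  B-isBlock : ∀ j → IsBlock U false (B j) × IsBlock V true (B j)
  B-isBlock j =
    Representation.isBlock fin U (free j) (dec-false (U.dec _ _) (proj₂ (free-holds j))) ((λ b → b) , (λ b → b)) ,
    Representation.isBlock fin V (free j) (dec-true (V.dec _ _) (proj₁ (free-holds j))) (regular _ (free-holds j))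

  ¬U-on-B : ∀ {j x y} → B j x → B j y → ¬ rel U x y
  ¬U-on-B {j} p q = proj₂ (free-holds j) ∘ U∼.rel-respˡ (U∼.∼-sym p) ∘ U∼.rel-respʳ (U∼.∼-sym q)

  V-on-B : ∀ {j x y} → B j x → B j y → rel V x y
  V-on-B {j} p q = V∼.rel-respˡ (B⇒V p) (V∼.rel-respʳ (B⇒V q) (proj₁ (free-holds j)))
    where
    B⇒V : ∀ {x} → B j x → free j V∼.∼ x
    B⇒V = proj₁ (regular (free j) (free-holds j))

  Kind : Fin 2 ⊎ Fin r → Pred X 0ℓ
  Kind (inj₁ zero)       x = rel U x x
  Kind (inj₁ (suc zero)) x = ¬ rel V x x
  Kind (inj₂ j)            = B j

  kind : ∀ x → ∃ λ i → Kind i x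
  kind x with U.dec x x | V.dec x x
  ... | yes u | _     = inj₁ zero , u
  ... | no _  | no ¬v = inj₁ (suc zero) , ¬v
  ... | no ¬u | yes v = let j , p = free-covers (v , ¬u) in inj₂ j , p

  kind-unique : ∀ {i j x} → Kind i x → Kind j x → i ≡ j
  kind-unique {inj₁ zero}       {inj₁ zero}       _  _  = refl
  kind-unique {inj₁ zero}       {inj₁ (suc zero)} u  ¬v = contradiction (U≤V u) ¬v
  kind-unique {inj₁ zero}       {inj₂ j}          u  p  = contradiction u (¬U-on-B p p)
  kind-unique {inj₁ (suc zero)} {inj₁ zero}       ¬v u  = contradiction (U≤V u) ¬v
  kind-unique {inj₁ (suc zero)} {inj₁ (suc zero)} _  _  = refl
  kind-unique {inj₁ (suc zero)} {inj₂ j}          ¬v p  = contradiction (V-on-B p p) ¬v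
  kind-unique {inj₂ j}          {inj₁ zero}       p  u  = contradiction u (¬U-on-B p p)
  kind-unique {inj₂ j}          {inj₁ (suc zero)} p  ¬v = contradiction (V-on-B p p) ¬v
  kind-unique {inj₂ i}          {inj₂ j}          p  q  = cong inj₂ (free-injective (U∼.∼-trans p (U∼.∼-sym q)))

  kind-closed : ∀ i {x y} → Kind i x → rel V x y → ¬ rel U x y → Kind i y
  kind-closed (inj₁ zero) = solid-closed {U = U} {V} U≤V regular
  kind-closed (inj₁ (suc zero)) ¬xx xy ¬xy =
    solid-closed {U = ∁ᵇ V} {∁ᵇ U} (∁ᵇ-antitone {U = U} {V} U≤V) (∁-regular {U = U} {V} regular) ¬xx ¬xy (λ ¬v → ¬v xy)
  kind-closed (inj₂ j) {x} {y} p xy ¬xy = U∼.∼-trans p x∼y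
    where
    x∼y : x U∼.∼ y
    -- If `V` holds in both directions, regularity gives equivalence in `U`. Otherwise `(y , x)` is
    -- outside `U` too, and two absences also mean equivalence.
    x∼y with V.dec y x
    ... | yes yx = proj₂ (regular x (V-on-B p p , ¬U-on-B p p)) (inj₁ (xy , yx))
    ... | no ¬yx = inj₂ (¬xy , ¬yx ∘ U≤V)

  rank : Fin 2 → ℕ
  rank zero       = Solid.size
  rank (suc zero) = Hollow.size

  Target : Poset _ _ _
  Target = ×-poset (Π-poset (λ i → ⊆-poset (rank i))) (Π-poset (λ j → BipOn (B j)))

  private
    module T = Poset Target
    module I = Poset (interval (Bip X) U V)

  merges : Bipartitional X → ∀ i → Subset (rank i)
  merges W zero       = Solid.merged W
  -- Passing to `∁ᵇ W` reverses inclusion; the complement of the subset restores it.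
  merges W (suc zero) = ∁ (Hollow.merged (∁ᵇ W))

  to : I.Carrier → T.Carrier
  to (W , _) = merges W , λ j → restrict W (B j)

  to-mono : ∀ {x y} → x I.≤ y → to x T.≤ to y
  to-mono {W , _} {W′ , _} W≤W′ =
    (λ { zero       → Solid.merged-mono W W′ W≤W′
       ; (suc zero) → p⊆q⇒∁p⊇∁q (Hollow.merged-mono (∁ᵇ W′) (∁ᵇ W) (∁ᵇ-antitone {U = W} {W′} W≤W′)) }) ,
    (λ j → W≤W′)

  -- Only pairs outside `U` matter; being in `V`, such a pair stays within the kind of `x`, so a
  -- single factor decides it.
  to-cancel : ∀ {x y} → to x T.≤ to y → x I.≤ y
  to-cancel {W , U≤W , W≤V} {W′ , U≤W′ , W′≤V} (m , ρ) {x} {y} xy with U.dec x y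
  ... | yes u = U≤W′ u
  ... | no ¬u with kind x
  ...   | inj₁ zero , xx =
    Solid.merged-cancel W W′ U≤W W≤V U≤W′ W′≤V (m zero) xx xy
  ...   | inj₁ (suc zero) , ¬xx = decidable-stable (Bipartitional.dec W′ x y) λ ¬xy →
    Hollow.merged-cancel (∁ᵇ W′) (∁ᵇ W)
      (∁ᵇ-antitone {U = W′} {V} W′≤V) (∁ᵇ-antitone {U = U} {W′} U≤W′)
      (∁ᵇ-antitone {U = W} {V} W≤V) (∁ᵇ-antitone {U = U} {W} U≤W)
      (∁p⊆∁q⇒p⊇q (m (suc zero))) ¬xx ¬xy xy
  ...   | inj₂ j , p =
    ρ j {x , [ p ]} {y , [ kind-closed (inj₂ j) p (W≤V xy) ¬u ]} xy

  module _ (S : ∀ i → Subset (rank i)) (R : ∀ j → Bipartitional (Refinement X (B j))) where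

    Local : Fin 2 ⊎ Fin r → Rel X 0ℓ
    Local (inj₁ zero)           = Solid.Join (S zero)
    Local (inj₁ (suc zero)) x y = ¬ Hollow.Join (∁ (S (suc zero))) x y
    Local (inj₂ j)          x y = Σ[ p ∈ B j x ] Σ[ q ∈ B j y ] rel (R j) (x , [ p ]) (y , [ q ])

    local-MemberOn : ∀ i → MemberOn U V (Kind i) (Local i)
    local-MemberOn (inj₁ zero)       = Solid.join-MemberOn (S zero)
    local-MemberOn (inj₁ (suc zero)) = ∁-MemberOn {U = U} {V} (Hollow.join-MemberOn (∁ (S (suc zero))))
    local-MemberOn (inj₂ j)          = record
      { dec-on         = λ {x} {y} p q → map′ (λ ρ → p , q , ρ) (λ (_ , _ , ρ) → ρ) (R.dec (x , [ p ]) (y , [ q ]))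
      ; lower          = λ p q u → contradiction u (¬U-on-B p q)
      ; upper          = λ p q _ → V-on-B p q
      ; transitive-on  = λ _ _ _ (p , _ , ρ) (_ , q , σ) → p , q , R.transitive ρ σ
      ; ctransitive-on = λ p q s ¬xy ¬yz (_ , _ , xz) →
          R.ctransitive {j = _ , [ q ]} (λ xy → ¬xy (p , q , xy)) (λ yz → ¬yz (q , s , yz)) xz
      }
      where module R = Bipartitional (R j)

    open Glue (⊎-≡-dec _≟ᶠ_ _≟ᶠ_) U V U≤V Kind kind kind-unique kind-closed Local local-MemberOn

    from : I.Carrier
    from = glue , inj₁ , glued⇒V

    to∘from : to from T.≈ (S , R)
    to∘from = subsets , blocks
      where
      subsets : ∀ i → merges glue i ≡ S i
      subsets zero = Solid.merged-join glue (S zero) glued⇒V (glued⁻ (inj₁ zero)) (glued⁺ (inj₁ zero))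
      -- Here `merged-join` runs in the complemented interval, where `∁ᵇ glue` agrees with `Join` up
      -- to a double negation; the last step cancels the double complement of the subset.
      subsets (suc zero) = trans
        (cong ∁ (Hollow.merged-join (∁ᵇ glue) (∁ (S (suc zero))) (λ ¬g u → ¬g (inj₁ u))
          (λ kx ky ¬g → decidable-stable
            (MemberOn.dec-on (Hollow.join-MemberOn (∁ (S (suc zero)))) kx ky)
            (¬g ∘ glued⁺ (inj₁ (suc zero)) kx ky))
          (λ kx ky l g → glued⁻ (inj₁ (suc zero)) kx ky g l)))
        (⊆-antisym (λ i∈ → x∉∁p⇒x∈p (x∈∁p⇒x∉p i∈)) (λ i∈ → x∉p⇒x∈∁p (x∈p⇒x∉∁p i∈)))

      blocks : ∀ j → Poset._≈_ (BipOn (B j)) (restrict glue (B j)) (R j)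
      blocks j =
        (λ { {x , [ p ]} {y , [ q ]} g →
               -- The membership proof carried by the comprehension is irrelevant; decidability of
               -- the equivalence recovers a usable one.
               let p′ = recompute (_ U∼.∼? _) p ; q′ = recompute (_ U∼.∼? _) q
                   _ , _ , ρ = glued⁻ (inj₂ j) p′ q′ g
               in ρ }) ,
        (λ { {x , [ p ]} {y , [ q ]} ρ →
               let p′ = recompute (_ U∼.∼? _) p ; q′ = recompute (_ U∼.∼? _) q
               in glued⁺ (inj₂ j) p′ q′ (p′ , q′ , ρ) })

  iso : interval (Bip X) U V ≅ Target
  iso = mk≅ (interval (Bip X) U V) Target to
    (λ {x} {y} → to-mono {x} {y}) (λ {x} {y} → to-cancel {x} {y}) (λ (S , R) → from S R , to∘from S R)

proposition10p2 : ∀ {X : Set} {n : ℕ} → X ↔ Fin n →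
    (U V : Bipartitional X) → Poset._≤_ (Bip X) U V → Regular U V →
    Σ[ m ∈ ℕ ] Σ[ rank ∈ (Fin m → ℕ) ]
    Σ[ r ∈ ℕ ] Σ[ B ∈ (Fin r → Pred X 0ℓ) ]
    (∀ j → IsBlock U false (B j) × IsBlock V true (B j)) ×
    (∀ {i j} → B i ≐ B j → i ≡ j) ×
    interval (Bip X) U V ≅
    ×-poset (Π-poset (λ i → ⊆-poset (rank i))) (Π-poset (λ j → BipOn (B j)))
-- The `2` Boolean factors come from the solid and the hollow points; either may have rank zero.
proposition10p2 fin U V U≤V regular = 2 , rank , _ , B , B-isBlock , B-injective , iso
  where open RegularInterval fin U V U≤V regular
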